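{- For every integer $j \geq 1$, the function $\mathrm{prh}_j$ is injective on the set of all partitions.
   Context: A partition $\lambda=(\lambda_1,\ldots,\lambda_\ell)$ is a weakly decreasing finite sequence of positive integers, identified with its multiset of parts. For $j\ge 1$, $\mathrm{prh}_j(\lambda)$ is the partition whose multiset of parts is $\{\!\{\lambda_{i_1}\cdots\lambda_{i_j} : 1\le i_1\le i_2\le\cdots\le i_j\le \ell\}\!\}$ (one part for each weakly increasing sequence of $j$ indices in $\{1,\ldots,\ell\}$, counted with multiplicity). -}

module Defs where

open import Data.Fin as Fin using (Fin)
open import Data.Fin.Properties as Fin using ()
open import Data.List using (List; []; _∷_; [_]; map; length; lookup; filter; allFin; cartesianProductWith)
open import Data.List.Membership.Propositional.Properties using (∈-lookup)
open import Data.List.Relation.Unary.All as All using (All)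
import Data.List.Relation.Unary.All.Properties as All
open import Data.List.Relation.Unary.Linked using (Linked)
open import Data.List.Relation.Binary.Permutation.Propositional using (↭-sym)
open import Data.List.Relation.Binary.Permutation.Propositional.Properties using (All-resp-↭)
open import Data.Nat using (ℕ; zero; suc; _≥_; NonZero)
open import Data.Nat.ListAction using (product)
open import Data.Nat.ListAction.Properties using (product≢0)
open import Data.Nat.Properties using (≤-decTotalOrder)
open import Data.Vec as Vec using (Vec; []; _∷_; toList)
open import Data.Vec.Relation.Unary.Linked as VecLinked using (linked?)
open import Relation.Binary.Construct.Flip.EqAndOrd using (decTotalOrder)
open import Relation.Unary using (Decidable)

-- Sorting with respect to _≥_, i.e. into weakly decreasing order.
open import Data.List.Sort (decTotalOrder ≤-decTotalOrder) using (sort; sort-↭; sort-↗)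

-- Both proof fields are propositions, so _≡_ on Partition is equality of the
-- underlying lists.  The empty partition is included.
record Partition : Set where
  constructor mkPartition
  field
    parts      : List ℕ
    positive   : All NonZero parts
    decreasing : Linked _≥_ parts

open Partition public

-- All j-tuples of indices below ℓ, each listed exactly once.
tuples : ∀ ℓ j → List (Vec (Fin ℓ) j)
tuples ℓ zero    = [ [] ]
tuples ℓ (suc j) = cartesianProductWith _∷_ (allFin ℓ) (tuples ℓ j)

WeaklyIncreasing : ∀ {ℓ j} → Vec (Fin ℓ) j → Set
WeaklyIncreasing = VecLinked.Linked Fin._≤_

weaklyIncreasing? : ∀ {ℓ j} → Decidable (WeaklyIncreasing {ℓ} {j})
weaklyIncreasing? = linked? Fin._≤?_

indexSequences : ∀ ℓ j → List (Vec (Fin ℓ) j)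
indexSequences ℓ j = filter weaklyIncreasing? (tuples ℓ j)

productAt : ∀ (xs : List ℕ) {j} → Vec (Fin (length xs)) j → ℕ
productAt xs is = product (toList (Vec.map (lookup xs) is))

products : ℕ → List ℕ → List ℕ
products j xs = map (productAt xs) (indexSequences (length xs) j)

productAt-nonZero : ∀ {xs} → All NonZero xs →
                    ∀ {j} (is : Vec (Fin (length xs)) j) → NonZero (productAt xs is)
productAt-nonZero {xs} xs≢0 is = product≢0 (entries is)
  where
  entries : ∀ {j} (is : Vec (Fin (length xs)) j) →
            All NonZero (toList (Vec.map (lookup xs) is))
  entries []       = All.[]
  entries (i ∷ is) = All.lookup xs≢0 (∈-lookup i) All.∷ entries is

products-nonZero : ∀ j {xs} → All NonZero xs → All NonZero (products j xs)
products-nonZero j xs≢0 =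
  All.map⁺ (All.universal (productAt-nonZero xs≢0) (indexSequences _ j))

prh : ℕ → Partition → Partition
prh j p = record
  { parts      = sort (products j (parts p))
  ; positive   = All-resp-↭ (↭-sym (sort-↭ _)) (products-nonZero j (positive p))
  ; decreasing = sort-↗ (products j (parts p))
  }

{-# OPTIONS --safe #-}
-- The largest product is λ₁ʲ, which determines λ₁.  Once λ₁, …, λₖ are known, cancel
-- the products of j-tuples of these parts; the largest remaining product is
-- λ₁ʲ⁻¹ λₖ₊₁, which determines λₖ₊₁, and nothing remains exactly when there is no
-- further part.
module Submission where

open import Defs
open import Data.Fin using (Fin; zero; suc; toℕ)
open import Data.List
  using (List; []; _∷_; _++_; _∷ʳ_; map; length; lookup; filter; tabulate; allFin; cartesianProductWith)
open import Data.List.Membership.Propositional using (_∈_)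
open import Data.List.Membership.Propositional.Properties using (∈-map⁺; ∈-++⁺ˡ; ∉[])
import Data.List.Properties as List
open import Data.List.Relation.Binary.Permutation.Propositional
  using (_↭_; ↭-refl; ↭-sym; module PermutationReasoning)
open import Data.List.Relation.Binary.Permutation.Propositional.Properties
  using (++⁺; ++⁺ˡ; map⁺; drop-∷; ∈-resp-↭; ++-assoc; shifts)
open import Data.List.Relation.Unary.All as All using (All; []; _∷_)
import Data.List.Relation.Unary.All.Properties as All
open import Data.List.Relation.Unary.Any using (here)
open import Data.List.Relation.Unary.Linked as Linked using (Linked)
open import Data.List.Relation.Unary.Linked.Properties using (Linked⇒All)
open import Data.Nat using (ℕ; zero; suc; _*_; _^_; _≤_; _≥_; _<_; _<?_; z≤n; s≤s; s≤s⁻¹; z<s; NonZero)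
open import Data.Nat.Properties
  using ( ≤-refl; ≤-trans; ≤-antisym; ≤-irrelevant; ≤-decTotalOrder; ≮⇒≥; <⇒≱; *-mono-≤; *-assoc
        ; *-cancelˡ-≤; *-identityˡ; *-identityʳ; ^-monoˡ-<; m^n≢0)
open import Data.Product using (_,_)
open import Data.Vec as Vec using (Vec; []; _∷_)
open import Data.Vec.Relation.Unary.All as VecAll using ([]; _∷_)
open import Data.Vec.Relation.Unary.Linked as VecLinked using ([]; [-]; _∷_)
import Data.Vec.Relation.Unary.Linked.Properties as VecLinked
open import Function using (_∘_; flip)
open import Function.Definitions using (Injective)
open import Level using (Level)
open import Relation.Binary.Construct.Flip.EqAndOrd using (decTotalOrder)
open import Relation.Binary.PropositionalEquality
  using (_≡_; refl; sym; trans; cong; cong₂; subst; module ≡-Reasoning)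
open import Relation.Nullary using (¬_; yes; no; contradiction)
open import Relation.Unary using (Pred; Decidable; _⊆_; Irrelevant)
open import Data.List.Sort (decTotalOrder ≤-decTotalOrder) using (sort-↭)

private
  variable
    a b p q : Level
    A : Set a
    B : Set b

-- Filtering lists.

module _ {P : Pred B p} (P? : Decidable P) (f : A → B) where

  filter-map : ∀ xs → filter P? (map f xs) ≡ map f (filter (P? ∘ f) xs)
  filter-map []       = refl
  filter-map (x ∷ xs) with P? (f x)
  ... | yes _ = cong (f x ∷_) (filter-map xs)
  ... | no  _ = filter-map xs

  filter-map-≐ : {Q : Pred A q} (Q? : Decidable Q) → P ∘ f ⊆ Q → Q ⊆ P ∘ f →
                 ∀ xs → filter P? (map f xs) ≡ map f (filter Q? xs)
  filter-map-≐ Q? P⊆Q Q⊆P xs =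
    trans (filter-map xs) (cong (map f) (List.filter-≐ (P? ∘ f) Q? (P⊆Q , Q⊆P) xs))

-- Read from right to left, this inserts a coarser filter in front of a finer one at no cost.
filter-filter : {P : Pred A p} {Q : Pred A q} (P? : Decidable P) (Q? : Decidable Q) → P ⊆ Q →
                ∀ xs → filter P? (filter Q? xs) ≡ filter P? xs
filter-filter P? Q? P⊆Q []       = refl
filter-filter P? Q? P⊆Q (x ∷ xs) with Q? x
... | no ¬q = trans (filter-filter P? Q? P⊆Q xs) (sym (List.filter-reject P? (¬q ∘ P⊆Q)))
... | yes _ with P? x
...   | yes _ = cong (x ∷_) (filter-filter P? Q? P⊆Q xs)
...   | no  _ = filter-filter P? Q? P⊆Q xs

-- Weakly increasing index sequences, split by their first index.

shift : ∀ {n j} → Vec (Fin n) j → Vec (Fin (suc n)) j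
shift = Vec.map suc

map-∷-shift : ∀ {n j} (i : Fin n) (vs : List (Vec (Fin n) j)) →
              map (suc i ∷_) (map shift vs) ≡ map shift (map (i ∷_) vs)
map-∷-shift i vs = trans (sym (List.map-∘ vs)) (List.map-∘ vs)

-- A decidable description of the image of `shift`.
AllPositive : ∀ {n j} → Vec (Fin n) j → Set
AllPositive = VecAll.All (λ i → 0 < toℕ i)

allPositive? : ∀ {n j} → Decidable (AllPositive {n} {j})
allPositive? = VecAll.all? (λ i → 0 <? toℕ i)

filter-allPositive-tuples : ∀ n j → filter allPositive? (tuples (suc n) j) ≡ map shift (tuples n j)
filter-allPositive-tuples n zero    = refl
filter-allPositive-tuples n (suc j) = begin
  filter allPositive? (map (zero ∷_) T ++ cartesianProductWith _∷_ (tabulate suc) T)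
    ≡⟨ List.filter-++ allPositive? (map (zero ∷_) T) _ ⟩
  filter allPositive? (map (zero ∷_) T) ++ filter allPositive? (cartesianProductWith _∷_ (tabulate suc) T)
    ≡⟨ cong₂ _++_ (List.filter-none allPositive? (All.map⁺ (All.universal (λ { _ (() ∷ _) }) T)))
                  -- Writing `tabulate suc` as a `map suc` allows `go` to recurse over an arbitrary
                  -- list of indices.
                  (cong (λ is → filter allPositive? (cartesianProductWith _∷_ is T)) (sym (List.map-tabulate (λ i → i) suc))) ⟩
  filter allPositive? (cartesianProductWith _∷_ (map suc (allFin n)) T)
    ≡⟨ go (allFin n) ⟩
  map shift (tuples n (suc j)) ∎
  where
  open ≡-Reasoning
  T = tuples (suc n) j

  go : ∀ is → filter allPositive? (cartesianProductWith _∷_ (map suc is) T)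
            ≡ map shift (cartesianProductWith _∷_ is (tuples n j))
  go []       = refl
  go (i ∷ is) = begin
    filter allPositive? (map (suc i ∷_) T ++ _)
      ≡⟨ List.filter-++ allPositive? (map (suc i ∷_) T) _ ⟩
    filter allPositive? (map (suc i ∷_) T) ++ _
      ≡⟨ cong₂ _++_ (filter-map-≐ allPositive? (suc i ∷_) allPositive? VecAll.tail (z<s ∷_) T) (go is) ⟩
    map (suc i ∷_) (filter allPositive? T) ++ _
      ≡⟨ cong (λ vs → map (suc i ∷_) vs ++ map shift R) (filter-allPositive-tuples n j) ⟩
    map (suc i ∷_) (map shift (tuples n j)) ++ _
      ≡⟨ cong (_++ map shift R) (map-∷-shift i (tuples n j)) ⟩
    map shift (map (i ∷_) (tuples n j)) ++ _
      ≡⟨ List.map-++ shift (map (i ∷_) (tuples n j)) _ ⟨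
    map shift (map (i ∷_) (tuples n j) ++ R) ∎
    where R = cartesianProductWith _∷_ is (tuples n j)

weaklyIncreasing-zero∷ : ∀ {n j} {v : Vec (Fin (suc n)) j} → WeaklyIncreasing v → WeaklyIncreasing (zero ∷ v)
weaklyIncreasing-zero∷ []          = [-]
weaklyIncreasing-zero∷ [-]         = z≤n ∷ [-]
weaklyIncreasing-zero∷ (i≤k ∷ inc) = z≤n ∷ i≤k ∷ inc

-- By transitivity every later index is at least `suc i`.
weaklyIncreasing-suc∷⇒allPositive : ∀ {n j} {i : Fin n} {v : Vec (Fin (suc n)) j} →
                                    WeaklyIncreasing (suc i ∷ v) → AllPositive v
weaklyIncreasing-suc∷⇒allPositive [-]         = []
weaklyIncreasing-suc∷⇒allPositive (i≤k ∷ inc) =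
  VecAll.map (≤-trans z<s) (VecLinked.Linked⇒All ≤-trans i≤k inc)

shift-weaklyIncreasing⁺ : ∀ {n j} {v : Vec (Fin n) j} → WeaklyIncreasing v → WeaklyIncreasing (shift v)
shift-weaklyIncreasing⁺ []                         = []
shift-weaklyIncreasing⁺ [-]                        = [-]
shift-weaklyIncreasing⁺ (_∷_ {xs = _ ∷ _} i≤k inc) = s≤s i≤k ∷ shift-weaklyIncreasing⁺ inc

shift-weaklyIncreasing⁻ : ∀ {n j} {v : Vec (Fin n) j} → WeaklyIncreasing (shift v) → WeaklyIncreasing v
shift-weaklyIncreasing⁻ {v = []}        _           = []
shift-weaklyIncreasing⁻ {v = _ ∷ []}    _           = [-]
shift-weaklyIncreasing⁻ {v = _ ∷ _ ∷ _} (i≤k ∷ inc) = s≤s⁻¹ i≤k ∷ shift-weaklyIncreasing⁻ inc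

-- A leading `zero` may be followed by any weakly increasing sequence; a positive leading index
-- forces all indices to be positive, so the sequence is a shifted one. This mirrors the recursion
-- that defines `h`.
indexSequences-suc : ∀ n j → indexSequences (suc n) (suc j) ≡
                     map (zero ∷_) (indexSequences (suc n) j) ++ map shift (indexSequences n (suc j))
indexSequences-suc n j = begin
  filter WI? (map (zero ∷_) T ++ cartesianProductWith _∷_ (tabulate suc) T)
    ≡⟨ List.filter-++ WI? (map (zero ∷_) T) _ ⟩
  filter WI? (map (zero ∷_) T) ++ filter WI? (cartesianProductWith _∷_ (tabulate suc) T)
    ≡⟨ cong₂ _++_ (filter-map-≐ WI? (zero ∷_) WI? VecLinked.tail weaklyIncreasing-zero∷ T)
                  (cong (λ is → filter WI? (cartesianProductWith _∷_ is T)) (sym (List.map-tabulate (λ i → i) suc))) ⟩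
  map (zero ∷_) (filter WI? T) ++ filter WI? (cartesianProductWith _∷_ (map suc (allFin n)) T)
    ≡⟨ cong (map (zero ∷_) (filter WI? T) ++_) (go (allFin n)) ⟩
  map (zero ∷_) (filter WI? T) ++ map shift (indexSequences n (suc j)) ∎
  where
  open ≡-Reasoning
  T = tuples (suc n) j

  WI? : ∀ {ℓ k} → Decidable (WeaklyIncreasing {ℓ} {k})
  WI? = weaklyIncreasing?

  step : ∀ i → filter WI? (map (suc i ∷_) T) ≡ map shift (filter WI? (map (i ∷_) (tuples n j)))
  step i = begin
    filter WI? (map (suc i ∷_) T)
      ≡⟨ filter-map WI? (suc i ∷_) T ⟩
    map (suc i ∷_) (filter (WI? ∘ (suc i ∷_)) T)
      -- Only positive tails can follow `suc i`, so the others may be discarded first; what is left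
      -- of `T` is the list of shifted tuples.
      ≡⟨ cong (map (suc i ∷_)) (filter-filter (WI? ∘ (suc i ∷_)) allPositive? weaklyIncreasing-suc∷⇒allPositive T) ⟨
    map (suc i ∷_) (filter (WI? ∘ (suc i ∷_)) (filter allPositive? T))
      ≡⟨ filter-map WI? (suc i ∷_) (filter allPositive? T) ⟨
    filter WI? (map (suc i ∷_) (filter allPositive? T))
      ≡⟨ cong (filter WI? ∘ map (suc i ∷_)) (filter-allPositive-tuples n j) ⟩
    filter WI? (map (suc i ∷_) (map shift (tuples n j)))
      ≡⟨ cong (filter WI?) (map-∷-shift i (tuples n j)) ⟩
    filter WI? (map shift (map (i ∷_) (tuples n j)))
      ≡⟨ filter-map-≐ WI? shift WI? shift-weaklyIncreasing⁻ shift-weaklyIncreasing⁺ (map (i ∷_) (tuples n j)) ⟩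
    map shift (filter WI? (map (i ∷_) (tuples n j))) ∎

  go : ∀ is → filter WI? (cartesianProductWith _∷_ (map suc is) T)
            ≡ map shift (filter WI? (cartesianProductWith _∷_ is (tuples n j)))
  go []       = refl
  go (i ∷ is) = begin
    filter WI? (map (suc i ∷_) T ++ _)
      ≡⟨ List.filter-++ WI? (map (suc i ∷_) T) _ ⟩
    filter WI? (map (suc i ∷_) T) ++ _
      ≡⟨ cong₂ _++_ (step i) (go is) ⟩
    map shift (filter WI? (map (i ∷_) (tuples n j))) ++ _
      ≡⟨ List.map-++ shift (filter WI? (map (i ∷_) (tuples n j))) _ ⟨
    map shift (filter WI? (map (i ∷_) (tuples n j)) ++ _)
      ≡⟨ cong (map shift) (List.filter-++ WI? (map (i ∷_) (tuples n j)) _) ⟨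
    map shift (filter WI? (map (i ∷_) (tuples n j) ++ _)) ∎

-- Complete homogeneous products.

-- The terms of the complete homogeneous symmetric polynomial, generated by the
-- recursion h_{j+1}(x, xs) = x h_j(x, xs) + h_{j+1}(xs).
h : ℕ → List ℕ → List ℕ
h zero    _        = 1 ∷ []
h (suc j) []       = []
h (suc j) (x ∷ xs) = map (x *_) (h j (x ∷ xs)) ++ h (suc j) xs

productAt-shift : ∀ x xs {j} (is : Vec (Fin (length xs)) j) →
                  productAt (x ∷ xs) (shift is) ≡ productAt xs is
productAt-shift x xs []       = refl
productAt-shift x xs (i ∷ is) = cong (lookup xs i *_) (productAt-shift x xs is)

products≡h : ∀ j xs → products j xs ≡ h j xs
products≡h zero    xs       = refl
products≡h (suc j) []       = refl
products≡h (suc j) (x ∷ xs) = begin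
  map (productAt (x ∷ xs)) (indexSequences (suc n) (suc j))
    ≡⟨ cong (map (productAt (x ∷ xs))) (indexSequences-suc n j) ⟩
  map (productAt (x ∷ xs)) (map (zero ∷_) (indexSequences (suc n) j) ++ map shift (indexSequences n (suc j)))
    ≡⟨ List.map-++ (productAt (x ∷ xs)) (map (zero ∷_) (indexSequences (suc n) j)) _ ⟩
  map (productAt (x ∷ xs)) (map (zero ∷_) (indexSequences (suc n) j))
    ++ map (productAt (x ∷ xs)) (map shift (indexSequences n (suc j)))
    -- On a sequence headed by `zero`, `productAt` reduces to `x` times the product over the tail,
    -- so fusing the two maps and splitting them again extracts the factor `x`.
    ≡⟨ cong₂ _++_ (trans (sym (List.map-∘ (indexSequences (suc n) j))) (List.map-∘ (indexSequences (suc n) j)))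
                  (trans (sym (List.map-∘ (indexSequences n (suc j))))
                         (List.map-cong (productAt-shift x xs) (indexSequences n (suc j)))) ⟩
  map (x *_) (products j (x ∷ xs)) ++ products (suc j) xs
    ≡⟨ cong₂ (λ us vs → map (x *_) us ++ vs) (products≡h j (x ∷ xs)) (products≡h (suc j) xs) ⟩
  h (suc j) (x ∷ xs) ∎
  where
  open ≡-Reasoning
  n = length xs

-- Cancelling the products over a common prefix.

-- The products of j factors from zs ++ us at least one of which comes from us.
rest : ℕ → List ℕ → List ℕ → List ℕ
rest zero    _        _  = []
rest (suc j) []       us = h (suc j) us
rest (suc j) (z ∷ zs) us = map (z *_) (rest j (z ∷ zs) us) ++ rest (suc j) zs us

-- A product either takes all its factors from `zs` or has at least one from `us`. The recursion
-- interleaves the two kinds, hence a permutation rather than an equality.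
h-++ : ∀ j zs us → h j (zs ++ us) ↭ h j zs ++ rest j zs us
h-++ zero    zs       us = ↭-refl
h-++ (suc j) []       us = ↭-refl
h-++ (suc j) (z ∷ zs) us = begin
  map (z *_) (h j (z ∷ zs ++ us)) ++ h (suc j) (zs ++ us)
    ↭⟨ ++⁺ (map⁺ (z *_) (h-++ j (z ∷ zs) us)) (h-++ (suc j) zs us) ⟩
  map (z *_) (h j (z ∷ zs) ++ rest j (z ∷ zs) us) ++ (h (suc j) zs ++ rest (suc j) zs us)
    ≡⟨ cong (_++ (h (suc j) zs ++ rest (suc j) zs us)) (List.map-++ (z *_) (h j (z ∷ zs)) _) ⟩
  (map (z *_) (h j (z ∷ zs)) ++ map (z *_) (rest j (z ∷ zs) us)) ++ (h (suc j) zs ++ rest (suc j) zs us)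
    ↭⟨ ++-assoc (map (z *_) (h j (z ∷ zs))) _ _ ⟩
  map (z *_) (h j (z ∷ zs)) ++ (map (z *_) (rest j (z ∷ zs) us) ++ (h (suc j) zs ++ rest (suc j) zs us))
    ↭⟨ ++⁺ˡ (map (z *_) (h j (z ∷ zs))) (shifts (map (z *_) (rest j (z ∷ zs) us)) (h (suc j) zs)) ⟩
  map (z *_) (h j (z ∷ zs)) ++ (h (suc j) zs ++ (map (z *_) (rest j (z ∷ zs) us) ++ rest (suc j) zs us))
    ↭⟨ ++-assoc (map (z *_) (h j (z ∷ zs))) _ _ ⟨
  h (suc j) (z ∷ zs) ++ rest (suc j) (z ∷ zs) us ∎
  where open PermutationReasoning

++-cancelˡ-↭ : ∀ (xs : List A) {ys zs} → xs ++ ys ↭ xs ++ zs → ys ↭ zs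
++-cancelˡ-↭ []       ys↭zs = ys↭zs
++-cancelˡ-↭ (x ∷ xs) ys↭zs = ++-cancelˡ-↭ xs (drop-∷ ys↭zs)

h-cancel-++ : ∀ j zs {xs ys} → h j (zs ++ xs) ↭ h j (zs ++ ys) → rest j zs xs ↭ rest j zs ys
h-cancel-++ j zs {xs} {ys} eq = ++-cancelˡ-↭ (h j zs) (begin
  h j zs ++ rest j zs xs ↭⟨ h-++ j zs xs ⟨
  h j (zs ++ xs)         ↭⟨ eq ⟩
  h j (zs ++ ys)         ↭⟨ h-++ j zs ys ⟩
  h j zs ++ rest j zs ys ∎)
  where open PermutationReasoning

-- The largest product and the largest remaining product.

h-bounded : ∀ j {m us} → All (_≤ m) us → All (_≤ m ^ j) (h j us)
h-bounded zero    us≤m         = ≤-refl ∷ []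
h-bounded (suc j) []           = []
h-bounded (suc j) (u≤m ∷ us≤m) =
  All.++⁺ (All.map⁺ (All.map (*-mono-≤ u≤m) (h-bounded j (u≤m ∷ us≤m)))) (h-bounded (suc j) us≤m)

-- Of the `suc j` factors, one comes from `us` and is at most `x`; each of the other `j` is at most
-- `m`, since `x ≤ m`.
rest-bounded : ∀ j {m x zs us} → All (_≤ m) zs → x ≤ m → All (_≤ x) us →
               All (_≤ m ^ j * x) (rest (suc j) zs us)
rest-bounded j {m} {x} [] x≤m us≤x = All.map (λ le → ≤-trans le (bound j)) (h-bounded (suc j) us≤x)
  where
  bound : ∀ j → x ^ suc j ≤ m ^ j * x
  bound zero    rewrite *-identityʳ x | *-identityˡ x = ≤-refl
  bound (suc j) rewrite *-assoc m (m ^ j) x = *-mono-≤ x≤m (bound j)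
-- A single factor that comes from `us` cannot be the head of the prefix: its block is a map over
-- `rest zero`, which is empty.
rest-bounded zero    (_ ∷ zs≤m)     x≤m us≤x = rest-bounded zero zs≤m x≤m us≤x
rest-bounded (suc j) {m} {x} {z ∷ _} (z≤m ∷ zs≤m) x≤m us≤x = All.++⁺
  (All.map⁺ (All.map bound (rest-bounded j (z≤m ∷ zs≤m) x≤m us≤x)))
  (rest-bounded (suc j) zs≤m x≤m us≤x)
  where
  bound : ∀ {p} → p ≤ m ^ j * x → z * p ≤ m ^ suc j * x
  bound p≤ rewrite *-assoc m (m ^ j) x = *-mono-≤ z≤m p≤

-- The bound of `h-bounded` is attained when the head is the maximum.
^∈h : ∀ j x xs → x ^ j ∈ h j (x ∷ xs)
^∈h zero    x xs = here refl
^∈h (suc j) x xs = ∈-++⁺ˡ (∈-map⁺ (x *_) (^∈h j x xs))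

∈rest-1 : ∀ zs y ys → y ∈ rest 1 zs (y ∷ ys)
∈rest-1 []       y ys = here (sym (*-identityʳ y))
∈rest-1 (z ∷ zs) y ys = ∈rest-1 zs y ys

-- The bound of `rest-bounded` is attained: take the prefix head `z` as often as possible and `y`
-- once.
^*∈rest : ∀ j z zs y ys → z ^ j * y ∈ rest (suc j) (z ∷ zs) (y ∷ ys)
^*∈rest zero    z zs y ys rewrite *-identityˡ y = ∈rest-1 zs y ys
^*∈rest (suc j) z zs y ys rewrite *-assoc z (z ^ j) y = ∈-++⁺ˡ (∈-map⁺ (z *_) (^*∈rest j z zs y ys))

-- Recovering the parts one by one.

Decreasing : List ℕ → Set
Decreasing = Linked _≥_

decreasing⇒bounded : ∀ {x xs} → Decreasing (x ∷ xs) → All (_≤ x) (x ∷ xs)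
decreasing⇒bounded = Linked⇒All (flip ≤-trans) ≤-refl

decreasing-++⁻ʳ : ∀ zs {us} → Decreasing (zs ++ us) → Decreasing us
decreasing-++⁻ʳ []       dec = dec
decreasing-++⁻ʳ (z ∷ zs) dec = decreasing-++⁻ʳ zs (Linked.tail dec)

-- The power `y ^ suc j` occurs on the left too, where nothing exceeds `x ^ suc j`. The exponent is
-- positive, so powers compare strictly.
first-≤ : ∀ j {x xs y ys} → Decreasing (x ∷ xs) → h (suc j) (x ∷ xs) ↭ h (suc j) (y ∷ ys) → y ≤ x
first-≤ j {y = y} {ys} dec eq = ≮⇒≥ λ x<y → <⇒≱ (^-monoˡ-< (suc j) x<y)
  (All.lookup (h-bounded (suc j) (decreasing⇒bounded dec)) (∈-resp-↭ (↭-sym eq) (^∈h (suc j) y ys)))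

-- After cancellation `z ^ j * y` occurs among products bounded by `z ^ j * x`, and `z ^ j` is
-- nonzero.
next-≤ : ∀ j z zs {x xs y ys} .{{_ : NonZero z}} → Decreasing (z ∷ zs ++ x ∷ xs) →
         h (suc j) (z ∷ zs ++ x ∷ xs) ↭ h (suc j) (z ∷ zs ++ y ∷ ys) → y ≤ x
next-≤ j z zs {x} {xs} {y} {ys} dec eq = *-cancelˡ-≤ (z ^ j) {{m^n≢0 z j}}
  (All.lookup (rest-bounded j (All.++⁻ˡ (z ∷ zs) bounded) (All.head (All.++⁻ʳ (z ∷ zs) bounded))
                 (decreasing⇒bounded (decreasing-++⁻ʳ (z ∷ zs) dec)))
              (∈-resp-↭ (↭-sym (h-cancel-++ (suc j) (z ∷ zs) eq)) (^*∈rest j z zs y ys)))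
  where bounded = decreasing⇒bounded dec

rest-[] : ∀ j zs → rest j zs [] ≡ []
rest-[] zero    zs       = refl
rest-[] (suc j) []       = refl
rest-[] (suc j) (z ∷ zs) = cong₂ (λ us vs → map (z *_) us ++ vs) (rest-[] j (z ∷ zs)) (rest-[] (suc j) zs)

-- After cancellation nothing remains on the left, while `z ^ j * y` remains on the right.
h-++-∷-≢ : ∀ j z zs {y ys} → ¬ (h (suc j) (z ∷ zs ++ []) ↭ h (suc j) (z ∷ zs ++ y ∷ ys))
h-++-∷-≢ j z zs {y} {ys} eq = ∉[] (subst (z ^ j * y ∈_) (rest-[] (suc j) (z ∷ zs))
  (∈-resp-↭ (↭-sym (h-cancel-++ (suc j) (z ∷ zs) eq)) (^*∈rest j z zs y ys)))

-- The known parts form a prefix that grows by one at each call. Its head `z` is kept apart because,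
-- as the largest part, it fixes the multiplier `z ^ j` throughout.
h-injective-after : ∀ j z zs xs ys .{{_ : NonZero z}} →
  Decreasing (z ∷ zs ++ xs) → Decreasing (z ∷ zs ++ ys) →
  h (suc j) (z ∷ zs ++ xs) ↭ h (suc j) (z ∷ zs ++ ys) → xs ≡ ys
h-injective-after j z zs []       []       _    _    _  = refl
h-injective-after j z zs []       (y ∷ ys) _    _    eq = contradiction eq (h-++-∷-≢ j z zs)
h-injective-after j z zs (x ∷ xs) []       _    _    eq = contradiction (↭-sym eq) (h-++-∷-≢ j z zs)
h-injective-after j z zs (x ∷ xs) (y ∷ ys) decx decy eq
  with refl ← ≤-antisym (next-≤ j z zs decy (↭-sym eq)) (next-≤ j z zs decx eq)
  -- The part just identified moves from the suffixes to the end of the prefix.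
  rewrite sym (List.∷ʳ-++ zs x xs) | sym (List.∷ʳ-++ zs x ys)
  = cong (x ∷_) (h-injective-after j z (zs ∷ʳ x) xs ys decx decy eq)

h-injective : ∀ j {xs ys} → All NonZero xs → Decreasing xs → Decreasing ys →
              h (suc j) xs ↭ h (suc j) ys → xs ≡ ys
h-injective j {[]}     {[]}     _ _ _ _  = refl
h-injective j {[]}     {y ∷ ys} _ _ _ eq = contradiction (∈-resp-↭ (↭-sym eq) (^∈h (suc j) y ys)) ∉[]
h-injective j {x ∷ xs} {[]}     _ _ _ eq = contradiction (∈-resp-↭ eq (^∈h (suc j) x xs)) ∉[]
h-injective j {x ∷ xs} {y ∷ ys} (x≢0 ∷ _) decx decy eq
  with refl ← ≤-antisym (first-≤ j decy (↭-sym eq)) (first-≤ j decx eq)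
  -- The common first part starts the prefix, and its positivity permits the later cancellations.
  = cong (x ∷_) (h-injective-after j x [] xs ys {{x≢0}} decx decy eq)

-- From lists of parts to partitions.

nonZero-irrelevant : Irrelevant NonZero
nonZero-irrelevant {suc _} _ _ = refl

parts-injective : Injective _≡_ _≡_ parts
parts-injective {mkPartition xs xs≢0 dec} {mkPartition _ xs≢0′ dec′} refl =
  cong₂ (mkPartition xs) (All.irrelevant nonZero-irrelevant xs≢0 xs≢0′) (Linked.irrelevant ≤-irrelevant dec dec′)

theorem5p1 : ∀ (j : ℕ) → j ≥ 1 → Injective _≡_ _≡_ (prh j)
theorem5p1 (suc j) _ {p} {q} eq = parts-injective
  (h-injective j (positive p) (decreasing p) (decreasing q) (begin
    h (suc j) (parts p)               ≡⟨ products≡h (suc j) (parts p) ⟨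
    -- Each sorted list is a permutation of its unsorted products, so equal images give permuted
    -- product lists.
    products (suc j) (parts p)        ↭⟨ sort-↭ (products (suc j) (parts p)) ⟨
    parts (prh (suc j) p)             ≡⟨ cong parts eq ⟩
    parts (prh (suc j) q)             ↭⟨ sort-↭ (products (suc j) (parts q)) ⟩
    products (suc j) (parts q)        ≡⟨ products≡h (suc j) (parts q) ⟩
    h (suc j) (parts q)               ∎))
  where open PermutationReasoning
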